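{- Let $\mathcal{F}=(X,\leq)$ be a poset and $j$ a nucleus on $\mathit{Up}(\mathcal{F})$. Let $I^{\mathcal{F},j}$ be a nuclear interpretation on $(\mathcal{F},j)$ that is consistent with $\vdash_\mathsf{IPC}$. Then $I^{\mathcal{F},j}=I^{\mathcal{F},j}_{\mathrm{st}}$, i.e. for all $j$-fixed upsets $U,V$: $I^{\mathcal{F},j}(\bot)=j\emptyset$, $I^{\mathcal{F},j}(\land)(U,V)=U\cap V$, $I^{\mathcal{F},j}(\lor)(U,V)=j(U\cup V)$, and $I^{\mathcal{F},j}(\to)(U,V)=\{x\in X: {\uparrow}x\cap U\subseteq V\}$.
   Context: The propositional language is generated by $\varphi ::= p \mid \bot \mid \varphi\land\varphi\mid\varphi\lor\varphi\mid\varphi\to\varphi$ with $p$ ranging over a countably infinite set $\mathit{Prop}$ of propositional variables; $\vdash_\mathsf{IPC}$ is the usual single-conclusion consequence relation of intuitionistic propositional logic (premises form a set, possibly empty). For a poset $\mathcal{F}=(X,\leq)$, $\mathit{Up}(\mathcal{F})$ is the set of upward closed subsets of $X$, and ${\uparrow}x=\{y: x\leq y\}$. A nucleus on $\mathit{Up}(\mathcal{F})$ is a map $j:\mathit{Up}(\mathcal{F})\to\mathit{Up}(\mathcal{F})$ with $U\subseteq jU$, $jjU\subseteq jU$, and $j(U\cap V)=jU\cap jV$ for all upsets $U,V$; $U$ is fixed if $jU=U$. A nuclear interpretation $I^{\mathcal{F},j}$ assigns to $\bot$ a fixed upset and to each of $\land,\lor,\to$ a binary function mapping pairs of fixed upsets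 to fixed upsets. A valuation is any map $v:\mathit{Prop}\to\mathit{Up}(\mathcal{F})$; semantic values are defined compositionally by $[\![p]\!]_v=j(v(p))$ and $[\![\#(\varphi_1,\dots,\varphi_n)]\!]_v=I^{\mathcal{F},j}(\#)([\![\varphi_1]\!]_v,\dots,[\![\varphi_n]\!]_v)$ (so all semantic values are fixed upsets). The interpretation is consistent with a consequence relation $\vdash$ if whenever $\Gamma\vdash\varphi$, for every valuation $v$, $\bigcap_{\psi\in\Gamma}[\![\psi]\!]_v\subseteq[\![\varphi]\!]_v$, where $\bigcap\emptyset=X$. The standard nuclear interpretation $I^{\mathcal{F},j}_{\mathrm{st}}$ is the one given by the formulas in the claim. -}

module Defs where

open import Algebra.Core using (Op₁; Op₂)
open import Algebra.Definitions using (Congruent₁; Congruent₂)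
open import Data.Nat.Base using (ℕ)
open import Data.Product.Base using (∃; _,_; proj₁)
open import Data.Sum.Base using (inj₁; inj₂)
open import Function.Base using (_on_)
open import Level using (Level; 0ℓ; _⊔_) renaming (suc to lsuc)
open import Relation.Binary.Bundles using (Poset)
open import Relation.Binary.Core using (Rel)
open import Relation.Binary.Definitions using (_Respects_)
open import Relation.Unary using (Pred; _∈_; _⊆_; _≐_; _∩_; _∪_; ⋂; ｛_｝)
open import Relation.Unary.Polymorphic using (∅)

infixr 7 _∧_
infixr 6 _∨_
infixr 5 _⇒_

data Formula : Set where
  var : ℕ → Formula
  ⊥   : Formula
  _∧_ : Formula → Formula → Formula
  _∨_ : Formula → Formula → Formula
  _⇒_ : Formula → Formula → Formula

private
  variable
    Γ     : Pred Formula 0ℓ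
    φ ψ χ : Formula

infix 4 _⊢_

-- Natural deduction; the set of premises is arbitrary, possibly infinite.
data _⊢_ : Pred Formula 0ℓ → Formula → Set₁ where
  assume : φ ∈ Γ → Γ ⊢ φ
  ⊥-E    : Γ ⊢ ⊥ → Γ ⊢ φ
  ∧-I    : Γ ⊢ φ → Γ ⊢ ψ → Γ ⊢ φ ∧ ψ
  ∧-E₁   : Γ ⊢ φ ∧ ψ → Γ ⊢ φ
  ∧-E₂   : Γ ⊢ φ ∧ ψ → Γ ⊢ ψ
  ∨-I₁   : Γ ⊢ φ → Γ ⊢ φ ∨ ψ
  ∨-I₂   : Γ ⊢ ψ → Γ ⊢ φ ∨ ψ
  ∨-E    : Γ ⊢ φ ∨ ψ → Γ ∪ ｛ φ ｝ ⊢ χ → Γ ∪ ｛ ψ ｝ ⊢ χ → Γ ⊢ χ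
  ⇒-I    : Γ ∪ ｛ φ ｝ ⊢ ψ → Γ ⊢ φ ⇒ ψ
  ⇒-E    : Γ ⊢ φ ⇒ ψ → Γ ⊢ φ → Γ ⊢ ψ

-- Upsets are predicates at level c ⊔ ℓ₂ ⊔ ℓ: it is at least c ⊔ ℓ₂, so that
-- they are closed under _⇨_, and otherwise arbitrary.
module Nuclear {c ℓ₁ ℓ₂ : Level} (F : Poset c ℓ₁ ℓ₂) (ℓ : Level) where

  open Poset F using (_≤_; trans) renaming (Carrier to X)

  record UpSet : Set (lsuc (c ⊔ ℓ₂ ⊔ ℓ)) where
    field
      ∣_∣    : Pred X (c ⊔ ℓ₂ ⊔ ℓ)
      closed : ∣_∣ Respects _≤_

  open UpSet public

  infix 4 _⊑_ _≋_

  _⊑_ : Rel UpSet (c ⊔ ℓ₂ ⊔ ℓ)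
  _⊑_ = _⊆_ on ∣_∣

  _≋_ : Rel UpSet (c ⊔ ℓ₂ ⊔ ℓ)
  _≋_ = _≐_ on ∣_∣

  ↑_ : X → Pred X ℓ₂
  (↑ x) y = x ≤ y

  infixr 7 _⊓_
  infixr 6 _⊔ᵘ_
  infixr 5 _⇨_

  ∅ᵘ : UpSet
  ∅ᵘ .∣_∣ = ∅
  ∅ᵘ .closed _ ()

  _⊓_ : Op₂ UpSet
  (U ⊓ V) .∣_∣ = ∣ U ∣ ∩ ∣ V ∣
  (U ⊓ V) .closed x≤y (u , v) = closed U x≤y u , closed V x≤y v

  _⊔ᵘ_ : Op₂ UpSet
  (U ⊔ᵘ V) .∣_∣ = ∣ U ∣ ∪ ∣ V ∣
  (U ⊔ᵘ V) .closed x≤y (inj₁ u) = inj₁ (closed U x≤y u)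
  (U ⊔ᵘ V) .closed x≤y (inj₂ v) = inj₂ (closed V x≤y v)

  _⇨_ : Op₂ UpSet
  (U ⇨ V) .∣_∣ x = ↑ x ∩ ∣ U ∣ ⊆ ∣ V ∣
  (U ⇨ V) .closed x≤y f (y≤z , u) = f (trans x≤y y≤z , u)

  -- Sets are compared extensionally, so every function on upsets comes with a
  -- proof that it respects _≋_.
  record Nucleus : Set (lsuc (c ⊔ ℓ₂ ⊔ ℓ)) where
    field
      j          : Op₁ UpSet
      j-cong     : Congruent₁ _≋_ j
      extensive  : ∀ U → U ⊑ j U
      idempotent : ∀ U → j (j U) ⊑ j U
      j-⊓        : ∀ U V → j (U ⊓ V) ≋ j U ⊓ j V

  module _ (N : Nucleus) where

    open Nucleus N

    record FixedUpSet : Set (lsuc (c ⊔ ℓ₂ ⊔ ℓ)) where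
      field
        upset : UpSet
        fixed : j upset ≋ upset

    open FixedUpSet public

    _≋ᶠ_ : Rel FixedUpSet (c ⊔ ℓ₂ ⊔ ℓ)
    _≋ᶠ_ = _≋_ on upset

    close : UpSet → FixedUpSet
    close U .upset = j U
    close U .fixed = idempotent U , extensive (j U)

    record NuclearInterpretation : Set (lsuc (c ⊔ ℓ₂ ⊔ ℓ)) where
      field
        ⊥ᴵ     : FixedUpSet
        ∧ᴵ     : Op₂ FixedUpSet
        ∨ᴵ     : Op₂ FixedUpSet
        ⇒ᴵ     : Op₂ FixedUpSet
        ∧-cong : Congruent₂ _≋ᶠ_ ∧ᴵ
        ∨-cong : Congruent₂ _≋ᶠ_ ∨ᴵ
        ⇒-cong : Congruent₂ _≋ᶠ_ ⇒ᴵ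

  Valuation : Set (lsuc (c ⊔ ℓ₂ ⊔ ℓ))
  Valuation = ℕ → UpSet

  module _ {N : Nucleus} (I : NuclearInterpretation N) where

    open NuclearInterpretation I

    ⟦_⟧ : Formula → Valuation → FixedUpSet N
    ⟦ var p ⟧ v = close N (v p)
    ⟦ ⊥ ⟧     v = ⊥ᴵ
    ⟦ φ ∧ ψ ⟧ v = ∧ᴵ (⟦ φ ⟧ v) (⟦ ψ ⟧ v)
    ⟦ φ ∨ ψ ⟧ v = ∨ᴵ (⟦ φ ⟧ v) (⟦ ψ ⟧ v)
    ⟦ φ ⇒ ψ ⟧ v = ⇒ᴵ (⟦ φ ⟧ v) (⟦ ψ ⟧ v)

    Consistent : ∀ {r} → (Pred Formula 0ℓ → Formula → Set r) →
                 Set (lsuc 0ℓ ⊔ lsuc (c ⊔ ℓ₂ ⊔ ℓ) ⊔ r)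
    Consistent _⊩_ = ∀ Γ φ → Γ ⊩ φ → ∀ (v : Valuation) →
      ⋂ (∃ Γ) (λ ψ → ∣ upset (⟦ proj₁ ψ ⟧ v) ∣) ⊆ ∣ upset (⟦ φ ⟧ v) ∣

{-# OPTIONS --safe #-}
-- Consistency turns derivability from one premise into inclusion of values.
-- The rules for ∧ force its value to be the intersection. Hence if ⟦ φ ⟧ ⊑ ⟦ χ ⟧,
-- then φ and φ ∧ χ have the same value, and, the interpretation being
-- compositional, one may be replaced by the other under any connective. So
-- semantic inclusions can be used as if they were derivable entailments, and
-- ∨ and ⇒ satisfy the universal properties of join and Heyting implication
-- among the semantic values.
module Submission where

open import Data.Nat.Base using (zero; suc)
open import Data.Product.Base using (_×_; _,_; proj₁; proj₂; swap)
open import Data.Sum.Base using (inj₁; inj₂; [_,_])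
open import Function.Base using (_∘_; id)
open import Level using (Level)
open import Relation.Binary.Bundles using (Poset)
open import Relation.Binary.PropositionalEquality using (refl)
open import Relation.Unary using (_∪_; ｛_｝)
open import Defs

module _ {c ℓ₁ ℓ₂ : Level} (F : Poset c ℓ₁ ℓ₂) (ℓ : Level) where

  open Nuclear F ℓ

  ≋-trans : ∀ U V W → U ≋ V → V ≋ W → U ≋ W
  ≋-trans _ _ _ (U⊑V , V⊑U) (V⊑W , W⊑V) = V⊑W ∘ U⊑V , V⊑U ∘ W⊑V

  ⊓-cong : ∀ U U′ V V′ → U ≋ U′ → V ≋ V′ → U ⊓ V ≋ U′ ⊓ V′
  ⊓-cong _ _ _ _ (f , f′) (g , g′) =
    (λ (u , v) → f u , g v) , (λ (u , v) → f′ u , g′ v)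

  module NucleusProperties (N : Nucleus) where

    open Nucleus N

    -- `U ⊑ V` amounts to `U ≋ U ⊓ V`, and `j` preserves `⊓`.
    j-mono : ∀ U V → U ⊑ V → j U ⊑ j V
    j-mono U V U⊑V =
      proj₂ ∘ proj₁ (j-⊓ U V) ∘ proj₁ (j-cong {U} {U ⊓ V} ((λ u → u , U⊑V u) , proj₁))

    j-least : ∀ U (V : FixedUpSet N) → U ⊑ upset V → j U ⊑ upset V
    j-least U V U⊑V = proj₁ (fixed V) ∘ j-mono U (upset V) U⊑V

  module ConsistentProperties
    (N : Nucleus) (I : NuclearInterpretation N) (con : Consistent I _⊢_) where

    open Nucleus N
    open NuclearInterpretation I
    open NucleusProperties N

    value : Formula → Valuation → UpSet
    value φ v = upset (⟦ I ⟧ φ v)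

    entails : ∀ φ ψ → ｛ φ ｝ ⊢ ψ → ∀ v → value φ v ⊑ value ψ v
    entails _ _ φ⊢ψ v x∈φ = con _ _ φ⊢ψ v λ { (_ , refl) → x∈φ }

    -- The elimination rules give one inclusion. The introduction rule, with the two conjuncts as
    -- separate premises, gives the other, since premises are interpreted by intersection.
    value-∧ : ∀ φ ψ v → value (φ ∧ ψ) v ≋ value φ v ⊓ value ψ v
    value-∧ φ ψ v =
      (λ x → entails (φ ∧ ψ) φ (∧-E₁ (assume refl)) v x ,
             entails (φ ∧ ψ) ψ (∧-E₂ (assume refl)) v x) ,
      (λ (x∈φ , x∈ψ) →
        con (｛ φ ｝ ∪ ｛ ψ ｝) (φ ∧ ψ)
          (∧-I (assume (inj₁ refl)) (assume (inj₂ refl))) v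
          λ { (_ , inj₁ refl) → x∈φ ; (_ , inj₂ refl) → x∈ψ })

    ∧-absorb : ∀ φ ψ v → value φ v ⊑ value ψ v → value φ v ≋ value (φ ∧ ψ) v
    ∧-absorb φ ψ v φ⊑ψ =
      (λ x → proj₂ (value-∧ φ ψ v) (x , φ⊑ψ x)) , proj₁ ∘ proj₁ (value-∧ φ ψ v)

    -- Conjoining `χ` to each disjunct leaves the value unchanged, and `χ` is derivable from the new
    -- disjunction.
    ∨-least : ∀ φ ψ χ v → value φ v ⊑ value χ v → value ψ v ⊑ value χ v →
              value (φ ∨ ψ) v ⊑ value χ v
    ∨-least φ ψ χ v φ⊑χ ψ⊑χ =
      entails ((φ ∧ χ) ∨ (ψ ∧ χ)) χ
        (∨-E (assume refl) (∧-E₂ (assume (inj₂ refl))) (∧-E₂ (assume (inj₂ refl)))) v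
      ∘ proj₁ (∨-cong {⟦ I ⟧ φ v} {⟦ I ⟧ (φ ∧ χ) v} {⟦ I ⟧ ψ v} {⟦ I ⟧ (ψ ∧ χ) v}
          (∧-absorb φ χ v φ⊑χ) (∧-absorb ψ χ v ψ⊑χ))

    ⇒-apply : ∀ φ ψ v → value (φ ⇒ ψ) v ⊓ value φ v ⊑ value ψ v
    ⇒-apply φ ψ v =
      entails ((φ ⇒ ψ) ∧ φ) ψ (⇒-E (∧-E₁ (assume refl)) (∧-E₂ (assume refl))) v
      ∘ proj₂ (value-∧ (φ ⇒ ψ) φ v)

    -- From `χ` derive `φ ⇒ (χ ∧ φ)`, replace the consequent by `(χ ∧ φ) ∧ ψ`, which has the same
    -- value, and weaken it to `ψ`.
    ⇒-curry : ∀ φ ψ χ v → value χ v ⊓ value φ v ⊑ value ψ v →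
              value χ v ⊑ value (φ ⇒ ψ) v
    ⇒-curry φ ψ χ v χφ⊑ψ =
      entails (φ ⇒ ((χ ∧ φ) ∧ ψ)) (φ ⇒ ψ)
        (⇒-I (∧-E₂ (⇒-E (assume (inj₁ refl)) (assume (inj₂ refl))))) v
      ∘ proj₁ (⇒-cong {⟦ I ⟧ φ v} {_} {⟦ I ⟧ (χ ∧ φ) v} {⟦ I ⟧ ((χ ∧ φ) ∧ ψ) v}
          (id , id) (∧-absorb (χ ∧ φ) ψ v (χφ⊑ψ ∘ proj₁ (value-∧ χ φ v))))
      ∘ entails χ (φ ⇒ (χ ∧ φ))
          (⇒-I (∧-I (assume (inj₁ refl)) (assume (inj₂ refl)))) v

    ⊥-value : upset ⊥ᴵ ≋ j ∅ᵘ
    ⊥-value =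
      -- A variable sent to `∅ᵘ` has value `j ∅ᵘ`, which is also the least fixed upset.
      entails ⊥ (var 0) (⊥-E (assume refl)) (λ _ → ∅ᵘ) ,
      j-least ∅ᵘ ⊥ᴵ (λ ())

    module _ (U V : FixedUpSet N) where

      -- `W` makes `j W` the value of the third variable, so that the expected value of a connective
      -- can be compared with formulas.
      valuation : UpSet → Valuation
      valuation W zero          = upset U
      valuation W (suc zero)    = upset V
      valuation W (suc (suc _)) = W

      p q r : Formula
      p = var 0
      q = var 1
      r = var 2

      ∧-value : upset (∧ᴵ U V) ≋ upset U ⊓ upset V
      ∧-value =
        ≋-trans (upset (∧ᴵ U V)) (value (p ∧ q) v) (upset U ⊓ upset V)
          -- The values of `p` and `q` are `j U` and `j V`, which agree with `U` and `V` by
          -- fixedness.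
          (∧-cong {U} {⟦ I ⟧ p v} {V} {⟦ I ⟧ q v} (swap (fixed U)) (swap (fixed V)))
          (≋-trans (value (p ∧ q) v) (value p v ⊓ value q v) (upset U ⊓ upset V)
            (value-∧ p q v)
            (⊓-cong (value p v) (upset U) (value q v) (upset V) (fixed U) (fixed V)))
        where v = valuation ∅ᵘ

      ∨-value : upset (∨ᴵ U V) ≋ j (upset U ⊔ᵘ upset V)
      ∨-value =
        ≋-trans (upset (∨ᴵ U V)) (value (p ∨ q) v) (j W)
          (∨-cong {U} {⟦ I ⟧ p v} {V} {⟦ I ⟧ q v} (swap (fixed U)) (swap (fixed V)))
          ( ∨-least p q r v (j-mono (upset U) W inj₁) (j-mono (upset V) W inj₂)
          , j-least W (⟦ I ⟧ (p ∨ q) v)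
              [ entails p (p ∨ q) (∨-I₁ (assume refl)) v ∘ extensive (upset U)
              , entails q (p ∨ q) (∨-I₂ (assume refl)) v ∘ extensive (upset V)
              ])
        where
        W = upset U ⊔ᵘ upset V
        v = valuation W

      ⇒-value : upset (⇒ᴵ U V) ≋ upset U ⇨ upset V
      ⇒-value =
        ≋-trans (upset (⇒ᴵ U V)) (value (p ⇒ q) v) W
          (⇒-cong {U} {⟦ I ⟧ p v} {V} {⟦ I ⟧ q v} (swap (fixed U)) (swap (fixed V)))
          ( (λ x (x≤y , y∈U) → proj₁ (fixed V)
              (⇒-apply p q v
                (closed (value (p ⇒ q) v) x≤y x , extensive (upset U) y∈U)))
          -- The premise reads `j W ⊓ j U ⊑ j V`. It follows from `W ⊓ U ⊑ V`, which is modus ponens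
          -- at the point itself, because `j` preserves `⊓`.
          , ⇒-curry p q r v
              (j-mono (W ⊓ upset U) (upset V) (λ (f , u) → f (refl≤ , u))
                ∘ proj₂ (j-⊓ W (upset U)))
            ∘ extensive W)
        where
        open Poset F using () renaming (refl to refl≤)
        W = upset U ⇨ upset V
        v = valuation W

theorem2 :
    {c ℓ₁ ℓ₂ : Level} (F : Poset c ℓ₁ ℓ₂) (ℓ : Level) →
    let open Nuclear F ℓ in
    (N : Nucleus) (I : NuclearInterpretation N) →
    let open Nucleus N
        open NuclearInterpretation I
    in
    Consistent I _⊢_ →
    (upset ⊥ᴵ ≋ j ∅ᵘ) ×
    ((U V : FixedUpSet N) →
      (upset (∧ᴵ U V) ≋ upset U ⊓ upset V) ×
      (upset (∨ᴵ U V) ≋ j (upset U ⊔ᵘ upset V)) ×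
      (upset (⇒ᴵ U V) ≋ upset U ⇨ upset V))
theorem2 F ℓ N I con =
  ⊥-value , λ U V → ∧-value U V , ∨-value U V , ⇒-value U V
  where open ConsistentProperties F ℓ N I con
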